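{- $\mathrm{DIS}\equiv_{\mathrm{sW}}\mathrm{NRNG}$, i.e., the discontinuity problem is strongly Weihrauch equivalent to the range non-equality problem.
   Context: A represented space is a set $X$ with a partial surjective map $\delta_X:\subseteq\mathbb N^{\mathbb N}\to X$. A problem is a partial multi-valued function $f:\subseteq X\rightrightarrows Y$ between represented spaces that has a realizer; a realizer of $f$ is a function $F:\subseteq\mathbb N^{\mathbb N}\to\mathbb N^{\mathbb N}$ with $\delta_YF(p)\in f\delta_X(p)$ for all $p\in\mathrm{dom}(f\delta_X)$. For problems $f,g$: $f\leq_{\mathrm{sW}}g$ if there are computable $H,K:\subseteq\mathbb N^{\mathbb N}\to\mathbb N^{\mathbb N}$ such that $HGK$ is a realizer of $f$ whenever $G$ is a realizer of $g$; $f\equiv_{\mathrm{sW}}g$ means $f\leq_{\mathrm{sW}}g$ and $g\leq_{\mathrm{sW}}f$. $\mathbb N^{\mathbb N}$ and $2^{\mathbb N}=\{0,1\}^{\mathbb N}$ are represented by (restrictions of) the identity; subsets $A\subseteq\mathbb N$ are identified with their characteristic functions in $2^{\mathbb N}$. $p-1\in\mathbb N^{\mathbb N}\cup\mathbb N^*$ denotes the finite or infinite concatenation of $p(0)-1,p(1)-1,\dots$, where $0-1$ is the empty word; thus $\mathrm{range}(p-1)=\{k:(\exists n)\ p(n)=k+1\}$. $\mathrm{NRNG}:\mathbb N^{\mathbb N}\rightrightarrows2^{\mathbb N}$, $p\mapsto\{A\in2^{\mathbb N}:A\neq\mathrm{range}(p-1)\}$. $\mathrm{DIS}:\mathbb N^{\mathbb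 N}\rightrightarrows\mathbb N^{\mathbb N}$, $p\mapsto\{q:\mathrm U(p)\neq q\}$ (every $q$ is a solution if $\mathrm U(p)$ is undefined), where $\mathrm U:\subseteq\mathbb N^{\mathbb N}\to\mathbb N^{\mathbb N}$ is $\mathrm U\langle\langle i,r\rangle,p\rangle:=\varphi_i^{\langle r,p\rangle}$ if this function is total and undefined otherwise. Here $\varphi^p$ is a standard Gödel numbering of the partial functions $\varphi_i^p:\subseteq\mathbb N\to\mathbb N$ computable relative to $p$; $\langle p,q\rangle(2n)=p(n)$, $\langle p,q\rangle(2n+1)=q(n)$ for $p,q\in\mathbb N^{\mathbb N}$; and $\langle i,r\rangle:=ir$ (concatenation) for $i\in\mathbb N$, $r\in\mathbb N^{\mathbb N}$. -}

module Defs where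

open import Data.Empty using (⊥-elim)
open import Data.Fin.Base using (Fin; toℕ)
open import Data.Fin.Patterns using (0F; 1F)
open import Data.Fin.Properties as Fin using (toℕ-injective)
open import Data.Nat.Base using (ℕ; zero; suc; _+_; _*_; _<_)
open import Data.Nat.Properties as ℕ using (<-cmp; *-suc; +-suc; +-identityʳ; suc-injective)
open import Data.Product using (∃; ∃₂; Σ-syntax; ∃-syntax; _×_; _,_; proj₁; proj₂)
open import Data.Sum.Base using (_⊎_; inj₁; inj₂)
open import Function.Base using (_∘_; const)
open import Function.Bundles using (_⇔_; mk⇔; Equivalence)
open import Level using (0ℓ)
open import Relation.Binary.Bundles using (Setoid)
open import Relation.Binary.Definitions using (tri<; tri≈; tri>)
open import Relation.Binary.PropositionalEquality
  using (_≡_; refl; sym; trans; cong; cong₂; subst; _≗_; _→-setoid_)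
open import Relation.Nullary.Negation using (¬_)

open Equivalence using (to; from)

-- Classical existence.  The theory of represented spaces is classical, and
-- membership in a domain is read with this quantifier throughout; read with Σ,
-- already "dom(DIS) is all of Baire space" would have no constructive proof.
-- Classically it is ordinary existence.
∃ᶜ : ∀ {a b} {A : Set a} → (A → Set b) → Set _
∃ᶜ P = ¬ ¬ ∃ P

------------------------------------------------------------------------
-- Baire and Cantor space as sets, with pointwise equality

𝔹 : Setoid 0ℓ 0ℓ
𝔹 = ℕ →-setoid ℕ

ℂ : Setoid 0ℓ 0ℓ
ℂ = ℕ →-setoid Fin 2

Baire Cantor : Set
Baire  = ℕ → ℕ
Cantor = ℕ → Fin 2

infixr 5 _◂_

_◂_ : ℕ → Baire → Baire
(i ◂ r) zero    = i
(i ◂ r) (suc n) = r n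

⟪_,_⟫ : Baire → Baire → Baire
⟪ p , q ⟫ zero    = p zero
⟪ p , q ⟫ (suc n) = ⟪ q , p ∘ suc ⟫ n

⟪⟫-even : ∀ p q n → ⟪ p , q ⟫ (2 * n) ≡ p n
⟪⟫-odd  : ∀ p q n → ⟪ p , q ⟫ (1 + 2 * n) ≡ q n
⟪⟫-even p q zero    = refl
⟪⟫-even p q (suc n) =
  trans (cong ⟪ p , q ⟫ (*-suc 2 n)) (⟪⟫-even (p ∘ suc) (q ∘ suc) n)
⟪⟫-odd p q n = ⟪⟫-even q (p ∘ suc) n

⟪⟫-cong : ∀ {p p′ q q′} → p ≗ p′ → q ≗ q′ → ⟪ p , q ⟫ ≗ ⟪ p′ , q′ ⟫
⟪⟫-cong e f zero    = e zero
⟪⟫-cong e f (suc n) = ⟪⟫-cong f (e ∘ suc) n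

------------------------------------------------------------------------
-- Partial functions, as single-valued relations

infix 4 _⇀_

record _⇀_ (X Y : Setoid 0ℓ 0ℓ) : Set₁ where
  private
    module X = Setoid X
    module Y = Setoid Y
  field
    graph        : X.Carrier → Y.Carrier → Set
    graph-resp   : ∀ {x x′ y y′} → x X.≈ x′ → y Y.≈ y′ → graph x y → graph x′ y′
    singleValued : ∀ {x y y′} → graph x y → graph x y′ → y Y.≈ y′

open _⇀_ public

infixr 9 _∘ₚ_

_∘ₚ_ : ∀ {X Y Z} → Y ⇀ Z → X ⇀ Y → X ⇀ Z
_∘ₚ_ {Y = Y} {Z} G F = record
  { graph        = λ x z → ∃[ y ] graph F x y × graph G y z
  ; graph-resp   = λ { x≈ z≈ (y , f , g) →
      y , graph-resp F x≈ (Setoid.refl Y) f , graph-resp G (Setoid.refl Y) z≈ g }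
  ; singleValued = λ { (y , f , g) (y′ , f′ , g′) →
      singleValued G g
        (graph-resp G (singleValued F f′ f) (Setoid.refl Z) g′) }
  }

------------------------------------------------------------------------
-- The Cantor pairing: ℕ × ℕ is enumerated along the antidiagonals as
-- (0,0), (1,0), (0,1), (2,0), (1,1), (0,2), …

triangle : ℕ → ℕ
triangle zero    = zero
triangle (suc s) = suc s + triangle s

⟨_,_⟩ : ℕ → ℕ → ℕ
⟨ a , b ⟩ = b + triangle (a + b)

next : ℕ × ℕ → ℕ × ℕ
next (zero  , b) = suc b , zero
next (suc a , b) = a , suc b

unpair : ℕ → ℕ × ℕ
unpair zero    = zero , zero
unpair (suc n) = next (unpair n)

π₁ π₂ : ℕ → ℕ
π₁ = proj₁ ∘ unpair
π₂ = proj₂ ∘ unpair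

private
  unpair-diagonal : ∀ s a b → a + b ≡ s → unpair (b + triangle s) ≡ (a , b)
  unpair-diagonal s a (suc b) e =
    cong next (unpair-diagonal s (suc a) b (trans (sym (+-suc a b)) e))
  unpair-diagonal zero    zero    zero e = refl
  unpair-diagonal (suc s) (suc a) zero e
    with refl ← trans (sym (+-identityʳ a)) (suc-injective e)
    = cong next (unpair-diagonal a zero a refl)

unpair-pair : ∀ a b → unpair ⟨ a , b ⟩ ≡ (a , b)
unpair-pair a b = unpair-diagonal (a + b) a b refl

π₁-pair : ∀ a b → π₁ ⟨ a , b ⟩ ≡ a
π₁-pair a b = cong proj₁ (unpair-pair a b)

π₂-pair : ∀ a b → π₂ ⟨ a , b ⟩ ≡ b
π₂-pair a b = cong proj₂ (unpair-pair a b)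

pair-unpair : ∀ n → ⟨ π₁ n , π₂ n ⟩ ≡ n
pair-unpair zero    = refl
pair-unpair (suc n) = trans (pair-next (unpair n)) (cong suc (pair-unpair n))
  where
  pair-next : ∀ z → ⟨ proj₁ (next z) , proj₂ (next z) ⟩ ≡ suc ⟨ proj₁ z , proj₂ z ⟩
  pair-next (zero  , b) = cong triangle (+-identityʳ (suc b))
  pair-next (suc a , b) = cong (λ s → suc b + triangle s) (+-suc a b)

⟨⟩-injective : ∀ {a b a′ b′} → ⟨ a , b ⟩ ≡ ⟨ a′ , b′ ⟩ → a ≡ a′ × b ≡ b′
⟨⟩-injective {a} {b} {a′} {b′} e =
    trans (sym (π₁-pair a b)) (trans (cong π₁ e) (π₁-pair a′ b′))
  , trans (sym (π₂-pair a b)) (trans (cong π₂ e) (π₂-pair a′ b′))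

------------------------------------------------------------------------
-- Partial recursive functions relative to an oracle.  All functions are unary;
-- several arguments are passed as Cantor pairs.

data Code : Set where
  zeroᶜ sucᶜ π₁ᶜ π₂ᶜ oracleᶜ : Code
  pairᶜ compᶜ recᶜ           : Code → Code → Code
  μᶜ                         : Code → Code

PrimRec : (F G : ℕ → ℕ → Set) → ℕ → ℕ → ℕ → Set
PrimRec F G x zero    b = F x b
PrimRec F G x (suc n) b = ∃[ y ] PrimRec F G x n y × G ⟨ x , ⟨ n , y ⟩ ⟩ b

Minimise : (F : ℕ → ℕ → Set) → ℕ → ℕ → Set
Minimise F a b = F ⟨ a , b ⟩ 0 × (∀ m → m < b → ∃[ k ] F ⟨ a , m ⟩ (suc k))

-- ⟦ c ⟧ p a b: the program c with oracle p halts on input a with output b.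
⟦_⟧ : Code → Baire → ℕ → ℕ → Set
⟦ zeroᶜ     ⟧ p a b = b ≡ 0
⟦ sucᶜ      ⟧ p a b = b ≡ suc a
⟦ π₁ᶜ       ⟧ p a b = b ≡ π₁ a
⟦ π₂ᶜ       ⟧ p a b = b ≡ π₂ a
⟦ oracleᶜ   ⟧ p a b = b ≡ p a
⟦ pairᶜ f g ⟧ p a b = ∃₂ λ x y → ⟦ f ⟧ p a x × ⟦ g ⟧ p a y × b ≡ ⟨ x , y ⟩
⟦ compᶜ f g ⟧ p a b = ∃[ x ] ⟦ g ⟧ p a x × ⟦ f ⟧ p x b
⟦ recᶜ f g  ⟧ p a b = PrimRec (⟦ f ⟧ p) (⟦ g ⟧ p) (π₁ a) (π₂ a) b
⟦ μᶜ f      ⟧ p a b = Minimise (⟦ f ⟧ p) a b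

⟦⟧-resp : ∀ c {p p′} → p ≗ p′ → ∀ {a b} → ⟦ c ⟧ p a b → ⟦ c ⟧ p′ a b
⟦⟧-resp zeroᶜ       e h = h
⟦⟧-resp sucᶜ        e h = h
⟦⟧-resp π₁ᶜ         e h = h
⟦⟧-resp π₂ᶜ         e h = h
⟦⟧-resp oracleᶜ     e {a} h = trans h (e a)
⟦⟧-resp (pairᶜ f g) e (x , y , hf , hg , eq) =
  x , y , ⟦⟧-resp f e hf , ⟦⟧-resp g e hg , eq
⟦⟧-resp (compᶜ f g) e (x , hg , hf) = x , ⟦⟧-resp g e hg , ⟦⟧-resp f e hf
⟦⟧-resp (recᶜ f g) {p} {p′} e {a} = go (π₂ a)
  where
  go : ∀ n {b} → PrimRec (⟦ f ⟧ p) (⟦ g ⟧ p) (π₁ a) n b →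
       PrimRec (⟦ f ⟧ p′) (⟦ g ⟧ p′) (π₁ a) n b
  go zero    h             = ⟦⟧-resp f e h
  go (suc n) (y , hr , hg) = y , go n hr , ⟦⟧-resp g e hg
⟦⟧-resp (μᶜ f) e (h₀ , h₊) =
  ⟦⟧-resp f e h₀ , λ m m<b → proj₁ (h₊ m m<b) , ⟦⟧-resp f e (proj₂ (h₊ m m<b))

⟦⟧-det : ∀ c {p a b b′} → ⟦ c ⟧ p a b → ⟦ c ⟧ p a b′ → b ≡ b′
⟦⟧-det zeroᶜ       h h′ = trans h (sym h′)
⟦⟧-det sucᶜ        h h′ = trans h (sym h′)
⟦⟧-det π₁ᶜ         h h′ = trans h (sym h′)
⟦⟧-det π₂ᶜ         h h′ = trans h (sym h′)
⟦⟧-det oracleᶜ     h h′ = trans h (sym h′)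
⟦⟧-det (pairᶜ f g) (x , y , hf , hg , e) (x′ , y′ , hf′ , hg′ , e′) =
  trans e (trans (cong₂ ⟨_,_⟩ (⟦⟧-det f hf hf′) (⟦⟧-det g hg hg′)) (sym e′))
⟦⟧-det (compᶜ f g) (x , hg , hf) (x′ , hg′ , hf′)
  with refl ← ⟦⟧-det g hg hg′ = ⟦⟧-det f hf hf′
⟦⟧-det (recᶜ f g) {p} {a} = go (π₂ a)
  where
  go : ∀ n {b b′} → PrimRec (⟦ f ⟧ p) (⟦ g ⟧ p) (π₁ a) n b →
       PrimRec (⟦ f ⟧ p) (⟦ g ⟧ p) (π₁ a) n b′ → b ≡ b′
  go zero    h            h′              = ⟦⟧-det f h h′
  go (suc n) (y , r , hg) (y′ , r′ , hg′)
    with refl ← go n r r′ = ⟦⟧-det g hg hg′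
⟦⟧-det (μᶜ f) {b = b} {b′} (h₀ , h₊) (h₀′ , h₊′) with <-cmp b b′
... | tri≈ _ b≡b′ _ = b≡b′
... | tri< b<b′ _ _ with () ← ⟦⟧-det f h₀ (proj₂ (h₊′ b b<b′))
... | tri> _ _ b′<b with () ← ⟦⟧-det f h₀′ (proj₂ (h₊ b′ b′<b))

-- A partial F is computable if one program computes F(p) from the oracle p for
-- every p in dom(F).
Computable : 𝔹 ⇀ 𝔹 → Set
Computable F = ∃[ c ] ∀ p q → graph F p q → ∀ n → ⟦ c ⟧ p n (q n)

-- Uniformity in the oracle makes this computability without any oracle.
Computableℕ : (ℕ → ℕ) → Set
Computableℕ s = ∃[ c ] ∀ p n → ⟦ c ⟧ p n (s n)

------------------------------------------------------------------------
-- Gödel numberings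

tag body : Code → ℕ
⌜_⌝ : Code → ℕ

tag zeroᶜ       = 0
tag sucᶜ        = 1
tag π₁ᶜ         = 2
tag π₂ᶜ         = 3
tag oracleᶜ     = 4
tag (pairᶜ _ _) = 5
tag (compᶜ _ _) = 6
tag (recᶜ _ _)  = 7
tag (μᶜ _)      = 8

body (pairᶜ f g) = ⟨ ⌜ f ⌝ , ⌜ g ⌝ ⟩
body (compᶜ f g) = ⟨ ⌜ f ⌝ , ⌜ g ⌝ ⟩
body (recᶜ f g)  = ⟨ ⌜ f ⌝ , ⌜ g ⌝ ⟩
body (μᶜ f)      = ⌜ f ⌝
body _           = 0

⌜ c ⌝ = ⟨ tag c , body c ⟩

⌜⌝-injective : ∀ c d → ⌜ c ⌝ ≡ ⌜ d ⌝ → c ≡ d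
private
  tag-body-injective : ∀ c d → tag c ≡ tag d → body c ≡ body d → c ≡ d
  tag-body-injective zeroᶜ       zeroᶜ       _ _ = refl
  tag-body-injective sucᶜ        sucᶜ        _ _ = refl
  tag-body-injective π₁ᶜ         π₁ᶜ         _ _ = refl
  tag-body-injective π₂ᶜ         π₂ᶜ         _ _ = refl
  tag-body-injective oracleᶜ     oracleᶜ     _ _ = refl
  tag-body-injective (pairᶜ f g) (pairᶜ h k) _ e =
    cong₂ pairᶜ (⌜⌝-injective f h (proj₁ (⟨⟩-injective e)))
                (⌜⌝-injective g k (proj₂ (⟨⟩-injective {⌜ f ⌝} {_} {⌜ h ⌝} e)))
  tag-body-injective (compᶜ f g) (compᶜ h k) _ e =
    cong₂ compᶜ (⌜⌝-injective f h (proj₁ (⟨⟩-injective e)))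
                (⌜⌝-injective g k (proj₂ (⟨⟩-injective {⌜ f ⌝} {_} {⌜ h ⌝} e)))
  tag-body-injective (recᶜ f g)  (recᶜ h k)  _ e =
    cong₂ recᶜ  (⌜⌝-injective f h (proj₁ (⟨⟩-injective e)))
                (⌜⌝-injective g k (proj₂ (⟨⟩-injective {⌜ f ⌝} {_} {⌜ h ⌝} e)))
  tag-body-injective (μᶜ f)      (μᶜ h)      _ e = cong μᶜ (⌜⌝-injective f h e)
⌜⌝-injective c d e =
  tag-body-injective c d (proj₁ (⟨⟩-injective e))
                         (proj₂ (⟨⟩-injective {tag c} {_} {tag d} e))

-- Numbers that are not codes index the nowhere defined function.
φ₀ : ℕ → Baire → ℕ → ℕ → Set
φ₀ i p n m = ∃[ c ] ⌜ c ⌝ ≡ i × ⟦ c ⟧ p n m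

-- Rogers' notion of a standard numbering of the partial functions computable
-- relative to p, uniformly in p: one that is intertranslatable, by total
-- computable index maps not depending on the oracle, with the numbering given
-- by programs.  φ i p n m reads φᵢᵖ(n) = m.
record GödelNumbering : Set₁ where
  field
    φ              : ℕ → Baire → ℕ → ℕ → Set
    toProgram      : ℕ → ℕ
    toProgram-comp : Computableℕ toProgram
    toProgram-corr : ∀ i p n m → φ i p n m ⇔ φ₀ (toProgram i) p n m
    fromProgram      : ℕ → ℕ
    fromProgram-comp : Computableℕ fromProgram
    fromProgram-corr : ∀ i p n m → φ₀ i p n m ⇔ φ (fromProgram i) p n m

  φ-resp : ∀ {i p p′ n m} → p ≗ p′ → φ i p n m → φ i p′ n m
  φ-resp {i} e h with c , ⌜c⌝≡ , hc ← to (toProgram-corr i _ _ _) h =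
    from (toProgram-corr i _ _ _) (c , ⌜c⌝≡ , ⟦⟧-resp c e hc)

  φ-det : ∀ {i p n m m′} → φ i p n m → φ i p n m′ → m ≡ m′
  φ-det {i} h h′
    with c , e , hc ← to (toProgram-corr i _ _ _) h
       | d , e′ , hd ← to (toProgram-corr i _ _ _) h′
    with refl ← ⌜⌝-injective c d (trans e (sym e′)) = ⟦⟧-det c hc hd

programNumbering : GödelNumbering
programNumbering = record
  { φ                = φ₀
  ; toProgram        = λ i → i
  ; toProgram-comp   = identity
  ; toProgram-corr   = λ _ _ _ _ → mk⇔ (λ h → h) (λ h → h)
  ; fromProgram      = λ i → i
  ; fromProgram-comp = identity
  ; fromProgram-corr = λ _ _ _ _ → mk⇔ (λ h → h) (λ h → h)
  }
  where
  identity : Computableℕ (λ i → i)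
  identity = pairᶜ π₁ᶜ π₂ᶜ , λ p n →
    π₁ n , π₂ n , refl , refl , sym (pair-unpair n)

------------------------------------------------------------------------
-- Represented spaces and problems

record RepresentedSpace : Set₁ where
  field
    points     : Setoid 0ℓ 0ℓ
    δ          : 𝔹 ⇀ points
    surjective : ∀ x → ∃ᶜ λ p → graph δ p x

  open Setoid points public

open RepresentedSpace using (points; δ; Carrier)

record _⇉_ (X Y : RepresentedSpace) : Set₁ where
  private
    module X = RepresentedSpace X
    module Y = RepresentedSpace Y
  field
    _∋_    : X.Carrier → Y.Carrier → Set
    ∋-resp : ∀ {x x′ y y′} → x X.≈ x′ → y Y.≈ y′ → x ∋ y → x′ ∋ y′

  dom : X.Carrier → Set
  dom x = ∃ᶜ λ y → x ∋ y

-- The quantifier expresses both that F(p) and δ_Y(F(p)) are defined and that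
-- the latter lies in f(x), as F and δ_Y are single-valued.
_Realizes_ : ∀ {X Y} → 𝔹 ⇀ 𝔹 → X ⇉ Y → Set
_Realizes_ {X} {Y} F f =
  ∀ p x → graph (δ X) p x → dom x →
  ∃ᶜ λ q → ∃[ y ] graph F p q × graph (δ Y) q y × x ∋ y
  where open _⇉_ f

record Problem (X Y : RepresentedSpace) : Set₁ where
  field
    multifunction : X ⇉ Y
    realizable    : ∃[ F ] F Realizes multifunction

open Problem public

infix 4 _≤sW_ _≡sW_

_≤sW_ : ∀ {X Y Z W} → Problem X Y → Problem Z W → Set₁
f ≤sW g =
  Σ[ H ∈ 𝔹 ⇀ 𝔹 ] Σ[ K ∈ 𝔹 ⇀ 𝔹 ] Computable H × Computable K ×
  (∀ G → G Realizes multifunction g → (H ∘ₚ G ∘ₚ K) Realizes multifunction f)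

_≡sW_ : ∀ {X Y Z W} → Problem X Y → Problem Z W → Set₁
f ≡sW g = f ≤sW g × g ≤sW f

------------------------------------------------------------------------
-- The spaces ℕ^ℕ and 2^ℕ

BaireSpace : RepresentedSpace
BaireSpace = record
  { points     = 𝔹
  ; δ          = record
    { graph        = _≗_
    ; graph-resp   = λ e f h n → trans (sym (e n)) (trans (h n) (f n))
    ; singleValued = λ h h′ n → trans (sym (h n)) (h′ n)
    }
  ; surjective = λ x k → k (x , λ _ → refl)
  }

CantorSpace : RepresentedSpace
CantorSpace = record
  { points     = ℂ
  ; δ          = record
    { graph        = λ p A → ∀ n → p n ≡ toℕ (A n)
    ; graph-resp   = λ e f h n → trans (sym (e n)) (trans (h n) (cong toℕ (f n)))
    ; singleValued = λ h h′ n → toℕ-injective (trans (sym (h n)) (h′ n))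
    }
  ; surjective = λ A k → k (toℕ ∘ A , λ _ → refl)
  }

-- Avoiding the value of a partial function (p ↦ any y with R(p) ≠ y) is
-- realizable when there are two distinct constants to answer with.
module _ (Y : RepresentedSpace) (R : 𝔹 ⇀ points Y) where
  private module Y = RepresentedSpace Y

  avoid : BaireSpace ⇉ Y
  avoid = record
    { _∋_    = λ p y → ¬ graph R p y
    ; ∋-resp = λ e f ¬r r →
        ¬r (graph-resp R (sym ∘ e) (Y.sym f) r)
    }

  avoid-realizable :
    ∀ {q₀ q₁ y₀ y₁} → graph (δ Y) q₀ y₀ → graph (δ Y) q₁ y₁ → ¬ y₀ Y.≈ y₁ →
    ∃[ F ] F Realizes avoid
  avoid-realizable {q₀} {q₁} {y₀} {y₁} d₀ d₁ y₀≉y₁ = F , realizes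
    where
    F : 𝔹 ⇀ 𝔹
    F = record
      { graph        = λ p q → (graph R p y₀ × q ≗ q₁) ⊎ (¬ graph R p y₀ × q ≗ q₀)
      ; graph-resp   = λ
        { e f (inj₁ (r , h)) →
            inj₁ (graph-resp R e Y.refl r , λ n → trans (sym (f n)) (h n))
        ; e f (inj₂ (¬r , h)) →
            inj₂ ( (λ r → ¬r (graph-resp R (sym ∘ e) Y.refl r))
                 , λ n → trans (sym (f n)) (h n)) }
      ; singleValued = λ
        { (inj₁ (_ , h)) (inj₁ (_ , h′)) n → trans (h n) (sym (h′ n))
        ; (inj₂ (_ , h)) (inj₂ (_ , h′)) n → trans (h n) (sym (h′ n))
        ; (inj₁ (r , _)) (inj₂ (¬r , _)) → ⊥-elim (¬r r)
        ; (inj₂ (¬r , _)) (inj₁ (r , _)) → ⊥-elim (¬r r) }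
      }

    realizes : F Realizes avoid
    realizes p x p≗x _ k = k (q₀ , y₀ , inj₂ (¬r , λ _ → refl) , d₀ ,
                              λ r → ¬r (graph-resp R (sym ∘ p≗x) Y.refl r))
      where
      ¬r : ¬ graph R p y₀
      ¬r r = k (q₁ , y₁ , inj₁ (r , λ _ → refl) , d₁ , λ r₁ →
               y₀≉y₁ (singleValued R r
                 (graph-resp R (sym ∘ p≗x) Y.refl r₁)))

------------------------------------------------------------------------
-- The range non-equality problem

_∈_ : ℕ → Cantor → Set
k ∈ A = A k ≡ 1F

-- RangeMinusOne relates p to the set A = range(p - 1).
RangeMinusOne : 𝔹 ⇀ ℂ
RangeMinusOne = record
  { graph        = λ p A → ∀ k → k ∈ A ⇔ (∃[ n ] p n ≡ suc k)
  ; graph-resp   = λ e f h k → mk⇔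
      (λ a → let n , pn = to (h k) (trans (f k) a) in n , trans (sym (e n)) pn)
      (λ { (n , pn) → trans (sym (f k)) (from (h k) (n , trans (e n) pn)) })
  ; singleValued = λ h h′ k →
      ext (λ a → from (h′ k) (to (h k) a)) (λ a → from (h k) (to (h′ k) a))
  }
  where
  ext : {i j : Fin 2} → (i ≡ 1F → j ≡ 1F) → (j ≡ 1F → i ≡ 1F) → i ≡ j
  ext {0F} {0F} _ _ = refl
  ext {1F} {1F} _ _ = refl
  ext {0F} {1F} _ g with () ← g refl
  ext {1F} {0F} f _ with () ← f refl

NRNG : Problem BaireSpace CantorSpace
NRNG = record
  { multifunction = avoid CantorSpace RangeMinusOne
  ; realizable    = avoid-realizable CantorSpace RangeMinusOne
      {y₀ = const 0F} {y₁ = const 1F}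
      (λ _ → refl) (λ _ → refl) (λ e → Fin.0≢1+n (e 0))
  }

------------------------------------------------------------------------
-- The discontinuity problem

module _ (𝒢 : GödelNumbering) where
  open GödelNumbering 𝒢

  U : 𝔹 ⇀ 𝔹
  U = record
    { graph        = λ s q → ∃[ i ] ∃[ r ] ∃[ p ]
                       s ≗ ⟪ i ◂ r , p ⟫ × (∀ n → φ i ⟪ r , p ⟫ n (q n))
    ; graph-resp   = λ { e f (i , r , p , s≗ , h) →
        i , r , p , (λ n → trans (sym (e n)) (s≗ n)) ,
        λ n → subst (φ i ⟪ r , p ⟫ n) (f n) (h n) }
    ; singleValued = λ { {y′ = q′} (i , r , p , s≗ , h) (i′ , r′ , p′ , s≗′ , h′) n →
        let eq : ⟪ i ◂ r , p ⟫ ≗ ⟪ i′ ◂ r′ , p′ ⟫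
            eq m = trans (sym (s≗ m)) (s≗′ m)
            r≗ : r ≗ r′
            r≗ m = trans (sym (⟪⟫-even (i ◂ r) p (suc m)))
                     (trans (eq (2 * suc m)) (⟪⟫-even (i′ ◂ r′) p′ (suc m)))
            p≗ : p ≗ p′
            p≗ m = trans (sym (⟪⟫-odd (i ◂ r) p m))
                     (trans (eq (1 + 2 * m)) (⟪⟫-odd (i′ ◂ r′) p′ m))
        in φ-det (h n)
             (φ-resp (λ m → sym (⟪⟫-cong r≗ p≗ m))
               (subst (λ j → φ j ⟪ r′ , p′ ⟫ n (q′ n)) (sym (eq 0)) (h′ n))) }
    }

  DIS : Problem BaireSpace BaireSpace
  DIS = record
    { multifunction = avoid BaireSpace U
    ; realizable    = avoid-realizable BaireSpace U
        {y₀ = const 0} {y₁ = const 1}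
        (λ _ → refl) (λ _ → refl) (λ e → ℕ.0≢1+n (e 0))
    }

{-# OPTIONS --safe #-}

-- DIS ≤ NRNG: enumerate {n : U(p)(n) ≠ 0} by simulating the program given by p.
-- If U(p) is the characteristic function of A, then this set is A; so every
-- solution A of NRNG for the enumeration is already a solution of DIS for p.
--
-- NRNG ≤ DIS: answer with the graph of q.  If graph(q) = range(p - 1), then q(n)
-- is found by searching p for an element ⟨n,k⟩ of its range, so q is the value
-- of U at an input computed from p; a q different from that value has a graph
-- different from range(p - 1).
module Submission where

open import Defs

open import Data.Fin.Base using (Fin; zero; suc; toℕ)
open import Data.Fin.Patterns
import Data.Fin.Properties as Fin
open import Data.Nat.Base using (ℕ; zero; suc; _+_; _*_; _∸_; _<_; z≤n; s≤s; pred)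
open import Data.Nat.GeneralisedArithmetic using (fold; fold-+)
open import Data.Nat.Properties
  using (+-comm; +-identityʳ; +-suc; m∸n≡0⇒m≤n; ≤-antisym; n∸n≡0; m+n≡0⇒m≡0;
         m+n≡0⇒n≡0; pred[m∸n]≡m∸[1+n]; m<n+m; 0≢1+n)
open import Data.Product using (∃-syntax; _×_; _,_; proj₁; proj₂)
open import Data.Sum.Base using (_⊎_; inj₁; inj₂)
open import Function.Base using (_∘_; const; _|>_)
open import Function.Bundles using (_⇔_; mk⇔; Equivalence)
open import Relation.Binary.PropositionalEquality
  using (_≡_; refl; sym; trans; cong; cong₂; subst; subst₂; _≗_)
open import Relation.Nullary.Negation using (¬_)

open Equivalence using (to; from)

-- Programs for total functions, uniformly in the oracle

Uniform : (Baire → ℕ → ℕ) → Set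
Uniform F = ∃[ c ] ∀ s n → ⟦ c ⟧ s n (F s n)

Uniform₂ : (Baire → ℕ → ℕ → ℕ) → Set
Uniform₂ F = Uniform λ s z → F s (π₁ z) (π₂ z)

private variable
  f g : Baire → ℕ → ℕ

extᵘ : (∀ s n → f s n ≡ g s n) → Uniform f → Uniform g
extᵘ e (c , h) = c , λ s n → subst (⟦ c ⟧ s n) (e s n) (h s n)

compᵘ : (f : Baire → ℕ → ℕ) → Uniform f → Uniform g → Uniform λ s n → f s (g s n)
compᵘ f (c , h) (d , k) = compᶜ c d , λ s n → _ , k s n , h s _

pairᵘ : Uniform f → Uniform g → Uniform λ s n → ⟨ f s n , g s n ⟩
pairᵘ (c , h) (d , k) = pairᶜ c d , λ s n → _ , _ , h s n , k s n , refl

idᵘ : Uniform λ _ n → n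
idᵘ = extᵘ (λ _ n → pair-unpair n) (pairᵘ (π₁ᶜ , λ _ _ → refl) (π₂ᶜ , λ _ _ → refl))

sucᵘ : Uniform f → Uniform λ s n → suc (f s n)
sucᵘ = compᵘ (λ _ → suc) (sucᶜ , λ _ _ → refl)

π₁ᵘ : Uniform f → Uniform λ s n → π₁ (f s n)
π₁ᵘ = compᵘ (λ _ → π₁) (π₁ᶜ , λ _ _ → refl)

π₂ᵘ : Uniform f → Uniform λ s n → π₂ (f s n)
π₂ᵘ = compᵘ (λ _ → π₂) (π₂ᶜ , λ _ _ → refl)

oracleᵘ : Uniform f → Uniform λ s n → s (f s n)
oracleᵘ = compᵘ (λ s → s) (oracleᶜ , λ _ _ → refl)

constᵘ : ∀ k → Uniform λ _ _ → k
constᵘ zero    = zeroᶜ , λ _ _ → refl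
constᵘ (suc k) = sucᵘ (constᵘ k)

unpaired : ∀ {a} {A : Set a} (F : ℕ → ℕ → A) x y → F (π₁ ⟨ x , y ⟩) (π₂ ⟨ x , y ⟩) ≡ F x y
unpaired F x y = cong (λ z → F (proj₁ z) (proj₂ z)) (unpair-pair x y)

comp₂ᵘ : (F : Baire → ℕ → ℕ → ℕ) → Uniform₂ F → Uniform f → Uniform g →
         Uniform λ s n → F s (f s n) (g s n)
comp₂ᵘ F hF hf hg = extᵘ (λ s n → unpaired (F s) _ _) (compᵘ _ hF (pairᵘ hf hg))

recᵘ : (F : Baire → ℕ → ℕ → ℕ) → Uniform (λ s x → F s x 0) → Uniform g →
       (∀ s x n → F s x (suc n) ≡ g s ⟨ x , ⟨ n , F s x n ⟩ ⟩) → Uniform₂ F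
recᵘ {g} F (c , h) (d , k) e = recᶜ c d , λ s z → go s (π₁ z) (π₂ z)
  where
  go : ∀ s x n → PrimRec (⟦ c ⟧ s) (⟦ d ⟧ s) x n (F s x n)
  go s x zero    = h s x
  go s x (suc n) = F s x n , go s x n , subst (⟦ d ⟧ s _) (sym (e s x n)) (k s _)

-- A primitive recursion whose step looks at the counter and discards the recursive value.
caseᵘ : (F : Baire → ℕ → ℕ → ℕ) → Uniform (λ s x → F s x 0) →
        Uniform₂ (λ s x n → F s x (suc n)) → Uniform₂ F
caseᵘ F h₀ h₊ = recᵘ F h₀
  (comp₂ᵘ (λ s x n → F s x (suc n)) h₊ (π₁ᵘ idᵘ) (π₁ᵘ (π₂ᵘ idᵘ)))
  λ s x n → sym (trans
    (unpaired (λ x z → F s x (suc (π₁ z))) x ⟨ n , F s x n ⟩)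
    (cong (F s x ∘ suc) (π₁-pair n (F s x n))))

switchᵘ : ∀ m (F : Baire → ℕ → ℕ → ℕ) →
          (∀ (i : Fin m) → Uniform λ s x → F s x (toℕ i)) →
          Uniform₂ (λ s x n → F s x (m + n)) → Uniform₂ F
switchᵘ zero    F hs h = h
switchᵘ (suc m) F hs h = caseᵘ F (hs zero) (switchᵘ m (λ s x n → F s x (suc n)) (hs ∘ suc) h)

uniform-cong : Uniform f → ∀ {s s′} → s ≗ s′ → f s ≗ f s′
uniform-cong (c , h) {s} {s′} e n = ⟦⟧-det c (⟦⟧-resp c e (h s n)) (h s′ n)

totalFunction : (T : Baire → Baire) → Uniform T → 𝔹 ⇀ 𝔹
totalFunction T hT = record
  { graph        = λ s q → q ≗ T s
  ; graph-resp   = λ e f h n → trans (sym (f n)) (trans (h n) (uniform-cong hT e n))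
  ; singleValued = λ h h′ n → trans (h n) (sym (h′ n))
  }

totalFunction-computable : ∀ T (hT : Uniform T) → Computable (totalFunction T hT)
totalFunction-computable T (c , h) =
  c , λ p q e n → subst (⟦ c ⟧ p n) (sym (e n)) (h p n)

-- Reductions between avoidance problems

open RepresentedSpace using (points; δ)

-- Single-valuedness forbids that both `y₀` and `y₁` are the value at `p`, so one of them is a
-- solution.
avoid-total : ∀ Y (R : 𝔹 ⇀ points Y) {y₀ y₁} → ¬ RepresentedSpace._≈_ Y y₀ y₁ →
              ∀ p → _⇉_.dom (avoid Y R) p
avoid-total Y R {y₀} {y₁} y₀≉y₁ p k =
  k (y₀ , λ r₀ → k (y₁ , λ r₁ → y₀≉y₁ (singleValued R r₀ r₁)))

-- By contraposition: if the answer `H q` named the forbidden value at `p`, then `z` would be the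
-- forbidden value at `K p`. As `H` sees only `q`, the reduction is strong.
avoid-reduction :
  ∀ {Y Z} (R : 𝔹 ⇀ points Y) (S : 𝔹 ⇀ points Z) →
  (∀ p → _⇉_.dom (avoid Z S) p) →
  (H K : Baire → Baire) (hH : Uniform H) (hK : Uniform K) →
  (∀ p q z → graph (δ Z) q z →
    ∃[ y ] graph (δ Y) (H q) y × (graph R p y → graph S (K p) z)) →
  ∀ F F′ → record { multifunction = avoid Y R ; realizable = F } ≤sW
           record { multifunction = avoid Z S ; realizable = F′ }
avoid-reduction {Y} {Z} R S S-total H K hH hK transfer _ _ =
  totalFunction H hH , totalFunction K hK ,
  totalFunction-computable H hH , totalFunction-computable K hK ,
  λ G G-realizes p x p≗x _ k →
    G-realizes (K p) (K p) (λ _ → refl) (S-total (K p))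
      λ { (q , z , Gq , q↦z , ¬Sz) →
        let y , Hq↦y , R⇒S = transfer p q z q↦z in
        k (H q , y , (q , (K p , (λ _ → refl) , Gq) , λ _ → refl) , Hq↦y ,
           λ Ry → ¬Sz (R⇒S (graph-resp R (sym ∘ p≗x) (RepresentedSpace.refl Y) Ry))) }

-- A universal machine

infixr 6 _∷_

-- The successor keeps every nonempty stack apart from the empty one, which is 0.
_∷_ : ℕ → ℕ → ℕ
k ∷ K = suc ⟨ k , K ⟩

-- Once the run at `n` has returned some `y`, the two frames with tag 10 build `⟨ x , ⟨ n , y ⟩ ⟩`,
-- the argument that the step program expects.
recAct : (d x n K : ℕ) → ℕ
recAct d x zero    K = ⟨ x , π₁ d ∷ K ⟩
recAct d x (suc n) K = ⟨ ⟨ x , n ⟩ , ⟨ 7 , d ⟩ ∷ ⟨ 10 , n ⟩ ∷ ⟨ 10 , x ⟩ ∷ π₂ d ∷ K ⟩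

μAct : (f a b v K : ℕ) → ℕ
μAct f a b zero    K = ⟨ b , K ⟩
μAct f a b (suc _) K = ⟨ ⟨ a , suc b ⟩ , f ∷ ⟨ 11 , ⟨ f , ⟨ a , suc b ⟩ ⟩ ⟩ ∷ K ⟩

-- A state ⟨ v , K ⟩ applies the frames on the stack K in turn to the value v.
-- A frame is the Gödel number of a program, or ⟨ t , d ⟩ with a tag t ≥ 9 for
-- the rest of a computation: 9 and 10 for the second component of a pair and
-- for the pairing, 11 for the test in an unbounded search.
act : Baire → (t d v K : ℕ) → ℕ
act w 0  d v K = ⟨ 0 , K ⟩
act w 1  d v K = ⟨ suc v , K ⟩
act w 2  d v K = ⟨ π₁ v , K ⟩
act w 3  d v K = ⟨ π₂ v , K ⟩
act w 4  d v K = ⟨ w v , K ⟩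
act w 5  d v K = ⟨ v , π₁ d ∷ ⟨ 9 , ⟨ v , π₂ d ⟩ ⟩ ∷ K ⟩
act w 6  d v K = ⟨ v , π₂ d ∷ π₁ d ∷ K ⟩
act w 7  d v K = recAct d (π₁ v) (π₂ v) K
act w 8  d v K = ⟨ ⟨ v , 0 ⟩ , d ∷ ⟨ 11 , ⟨ d , ⟨ v , 0 ⟩ ⟩ ⟩ ∷ K ⟩
act w 9  d v K = ⟨ π₁ d , π₂ d ∷ ⟨ 10 , v ⟩ ∷ K ⟩
act w 10 d v K = ⟨ ⟨ d , v ⟩ , K ⟩
act w (suc (suc (suc (suc (suc (suc (suc (suc (suc (suc (suc _))))))))))) d v K =
  μAct (π₁ d) (π₁ (π₂ d)) (π₂ (π₂ d)) v K

stepAt : Baire → (v K : ℕ) → ℕ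
stepAt w v zero    = ⟨ v , 0 ⟩
stepAt w v (suc k) = act w (π₁ (π₁ k)) (π₂ (π₁ k)) v (π₂ k)

step : Baire → ℕ → ℕ
step w σ = stepAt w (π₁ σ) (π₂ σ)

module _ (w : Baire) where

  infix  4 _⟶*_
  infixr 5 _▷_

  _⟶*_ : ℕ → ℕ → Set
  σ ⟶* τ = ∃[ t ] fold σ (step w) t ≡ τ

  _▷_ : ∀ {σ τ υ} → σ ⟶* τ → τ ⟶* υ → σ ⟶* υ
  _▷_ {σ} (t , refl) (u , refl) = u + t , fold-+ σ (step w) u

  fire : ∀ t d v K {τ} → act w t d v K ≡ τ → ⟨ v , ⟨ t , d ⟩ ∷ K ⟩ ⟶* τ
  fire t d v K e = 1 , trans (unpaired (stepAt w) v (⟨ t , d ⟩ ∷ K))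
    (trans (unpaired (λ k K → act w (π₁ k) (π₂ k) v K) ⟨ t , d ⟩ K)
    (trans (unpaired (λ t d → act w t d v K) t d) e))

  halt-stable : ∀ b t → fold ⟨ b , 0 ⟩ (step w) t ≡ ⟨ b , 0 ⟩
  halt-stable b zero    = refl
  halt-stable b (suc t) = trans (cong (step w) (halt-stable b t)) (unpaired (stepAt w) b 0)

  -- After `u + t` steps both runs have halted and stayed put, so the two results are read from one
  -- and the same state.
  halt-unique : ∀ {σ b b′} → σ ⟶* ⟨ b , 0 ⟩ → σ ⟶* ⟨ b′ , 0 ⟩ → b ≡ b′
  halt-unique {σ} {b} {b′} (t , e) (u , e′) = proj₁ (⟨⟩-injective {b} {0} {b′} {0}
    (trans (sym (later {b} t u e))
    (trans (cong (fold σ (step w)) (+-comm u t)) (later {b′} u t e′))))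
    where
    later : ∀ {c} t u → fold σ (step w) t ≡ ⟨ c , 0 ⟩ → fold σ (step w) (u + t) ≡ ⟨ c , 0 ⟩
    later {c} t u e = trans (fold-+ σ (step w) u)
      (trans (cong (λ τ → fold τ (step w) u) e) (halt-stable c u))

  -- Only this direction is needed: the machine is deterministic, so for a halting
  -- program its result can only be the right one.
  simulates : ∀ c {a b} → ⟦ c ⟧ w a b → ∀ K → ⟨ a , ⌜ c ⌝ ∷ K ⟩ ⟶* ⟨ b , K ⟩
  simulates zeroᶜ   {a} refl K = fire 0 0 a K refl
  simulates sucᶜ    {a} refl K = fire 1 0 a K refl
  simulates π₁ᶜ     {a} refl K = fire 2 0 a K refl
  simulates π₂ᶜ     {a} refl K = fire 3 0 a K refl
  simulates oracleᶜ {a} refl K = fire 4 0 a K refl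
  simulates (pairᶜ f g) {a} (x , y , hf , hg , refl) K =
      fire 5 ⟨ ⌜ f ⌝ , ⌜ g ⌝ ⟩ a K (unpaired (λ f g → ⟨ a , f ∷ ⟨ 9 , ⟨ a , g ⟩ ⟩ ∷ K ⟩) ⌜ f ⌝ ⌜ g ⌝)
    ▷ simulates f hf _
    ▷ fire 9 ⟨ a , ⌜ g ⌝ ⟩ x K (unpaired (λ a g → ⟨ a , g ∷ ⟨ 10 , x ⟩ ∷ K ⟩) a ⌜ g ⌝)
    ▷ simulates g hg _
    ▷ fire 10 x y K refl
  simulates (compᶜ f g) {a} (x , hg , hf) K =
      fire 6 ⟨ ⌜ f ⌝ , ⌜ g ⌝ ⟩ a K (unpaired (λ f g → ⟨ a , g ∷ f ∷ K ⟩) ⌜ f ⌝ ⌜ g ⌝)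
    ▷ simulates g hg _
    ▷ simulates f hf K
  simulates (recᶜ f g) {a} {b} h K =
    -- The induction runs over the second component, so the input is first written as a pair.
    subst (λ a → ⟨ a , ⌜ recᶜ f g ⌝ ∷ K ⟩ ⟶* ⟨ b , K ⟩) (pair-unpair a) (go (π₂ a) h K)
    where
    x = π₁ a
    fg = ⟨ ⌜ f ⌝ , ⌜ g ⌝ ⟩
    go : ∀ n {b} → PrimRec (⟦ f ⟧ w) (⟦ g ⟧ w) x n b →
         ∀ K → ⟨ ⟨ x , n ⟩ , ⟨ 7 , fg ⟩ ∷ K ⟩ ⟶* ⟨ b , K ⟩
    go zero h K =
        fire 7 fg ⟨ x , 0 ⟩ K
          (trans (unpaired (λ x n → recAct fg x n K) x 0)
                 (unpaired (λ f _ → ⟨ x , f ∷ K ⟩) ⌜ f ⌝ ⌜ g ⌝))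
      ▷ simulates f h K
    go (suc n) (y , hr , hg) K =
        fire 7 fg ⟨ x , suc n ⟩ K
          (trans (unpaired (λ x n → recAct fg x n K) x (suc n))
                 (unpaired (λ _ g → ⟨ ⟨ x , n ⟩ , ⟨ 7 , fg ⟩ ∷ ⟨ 10 , n ⟩ ∷ ⟨ 10 , x ⟩ ∷ g ∷ K ⟩)
                           ⌜ f ⌝ ⌜ g ⌝))
      ▷ go n hr _
      ▷ fire 10 n y _ refl
      ▷ fire 10 x ⟨ n , y ⟩ _ refl
      ▷ simulates g hg K
  simulates (μᶜ f) {a} {b} (h₀ , h₊) K =
    fire 8 ⌜ f ⌝ a K refl ▷ go b 0 (+-comm b 0)
    where
    loop : ℕ → ℕ
    loop m = ⟨ 11 , ⟨ ⌜ f ⌝ , ⟨ a , m ⟩ ⟩ ⟩ ∷ K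
    test : ∀ m v {τ} → μAct ⌜ f ⌝ a m v K ≡ τ → ⟨ v , loop m ⟩ ⟶* τ
    test m v e = fire 11 ⟨ ⌜ f ⌝ , ⟨ a , m ⟩ ⟩ v K
      (trans (unpaired (λ f z → μAct f (π₁ z) (π₂ z) v K) ⌜ f ⌝ ⟨ a , m ⟩)
      (trans (unpaired (λ a m → μAct ⌜ f ⌝ a m v K) a m) e))
    go : ∀ k m → k + m ≡ b → ⟨ ⟨ a , m ⟩ , ⌜ f ⌝ ∷ loop m ⟩ ⟶* ⟨ b , K ⟩
    go zero    m refl = simulates f h₀ _ ▷ test b 0 refl
    go (suc k) m e    with v , h ← h₊ m (subst (m <_) e (m<n+m m (s≤s z≤n))) =
        simulates f h _
      ▷ test m (suc v) refl
      ▷ go k (suc m) (trans (+-suc k m) e)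

-- Computability of the machine's step

infixr 6 _∷ᵘ_

_∷ᵘ_ : Uniform f → Uniform g → Uniform λ s n → f s n ∷ g s n
h ∷ᵘ k = sucᵘ (pairᵘ h k)

-- The machine has a computed oracle `W s`, because the simulation must answer oracle calls with
-- `⟪ r , p ⟫` while its own oracle also carries the index.
stepᵘ : ∀ {W : Baire → Baire} → Uniform W → Uniform f → Uniform λ s n → step (W s) (f s n)
stepᵘ {W = W} hW h =
  comp₂ᵘ atStack (caseᵘ atStack (pairᵘ idᵘ (constᵘ 0))
    (comp₂ᵘ atTag (switchᵘ 11 atTag branches
        (compᵘ _ (comp₂ᵘ atTest μActᵘ idᵘ (π₁ᵘ (π₂ᵘ idᵘ))) (π₁ᵘ idᵘ)))
      (pairᵘ (π₂ᵘ (π₁ᵘ (π₂ᵘ idᵘ))) (pairᵘ (π₁ᵘ idᵘ) (π₂ᵘ (π₂ᵘ idᵘ))))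
      (π₁ᵘ (π₁ᵘ (π₂ᵘ idᵘ)))
    |> extᵘ λ s z →
      trans (unpaired (λ d x → act (W s) (π₁ (π₁ (π₂ z))) d (π₁ x) (π₂ x))
               (π₂ (π₁ (π₂ z))) ⟨ π₁ z , π₂ (π₂ z) ⟩)
            (unpaired (act (W s) (π₁ (π₁ (π₂ z))) (π₂ (π₁ (π₂ z)))) (π₁ z) (π₂ (π₂ z)))))
  (π₁ᵘ h) (π₂ᵘ h)
  where
  atStack atTag atTest atRec : Baire → ℕ → ℕ → ℕ
  atStack s v K = stepAt (W s) v K
  -- `x` packs `⟨ d , ⟨ v , K ⟩ ⟩`, which leaves the tag as the last argument, the one that case
  -- distinctions act on.
  atTag  s x t = act (W s) t (π₁ x) (π₁ (π₂ x)) (π₂ (π₂ x))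
  atTest s x v = μAct (π₁ (π₁ x)) (π₁ (π₂ (π₁ x))) (π₂ (π₂ (π₁ x))) v (π₂ (π₂ x))
  atRec  s x n = recAct (π₁ x) (π₁ (π₁ (π₂ x))) n (π₂ (π₂ x))

  d = π₁ᵘ idᵘ
  v = π₁ᵘ (π₂ᵘ idᵘ)
  K = π₂ᵘ (π₂ᵘ idᵘ)

  μActᵘ : Uniform₂ atTest
  μActᵘ = caseᵘ atTest (pairᵘ (π₂ᵘ (π₂ᵘ d)) K)
    (compᵘ _ (pairᵘ next-arg (π₁ᵘ d ∷ᵘ pairᵘ (constᵘ 11) (pairᵘ (π₁ᵘ d) next-arg) ∷ᵘ K))
             (π₁ᵘ idᵘ))
    where
    next-arg = pairᵘ (π₁ᵘ (π₂ᵘ d)) (sucᵘ (π₂ᵘ (π₂ᵘ d)))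

  recActᵘ : Uniform₂ atRec
  recActᵘ = caseᵘ atRec (pairᵘ (π₁ᵘ v) (π₁ᵘ d ∷ᵘ K))
    (pairᵘ (pairᵘ x n)
      (pairᵘ (constᵘ 7) (π₁ᵘ (π₁ᵘ idᵘ)) ∷ᵘ pairᵘ (constᵘ 10) n ∷ᵘ pairᵘ (constᵘ 10) x
        ∷ᵘ π₂ᵘ (π₁ᵘ (π₁ᵘ idᵘ)) ∷ᵘ π₂ᵘ (π₂ᵘ (π₁ᵘ idᵘ))))
    where
    x = π₁ᵘ (π₁ᵘ (π₂ᵘ (π₁ᵘ idᵘ)))
    n = π₂ᵘ idᵘ

  branches : ∀ (i : Fin 11) → Uniform λ s x → atTag s x (toℕ i)
  branches 0F = pairᵘ (constᵘ 0) K
  branches 1F = pairᵘ (sucᵘ v) K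
  branches 2F = pairᵘ (π₁ᵘ v) K
  branches 3F = pairᵘ (π₂ᵘ v) K
  branches 4F = pairᵘ (compᵘ W hW v) K
  branches 5F = pairᵘ v (π₁ᵘ d ∷ᵘ pairᵘ (constᵘ 9) (pairᵘ v (π₂ᵘ d)) ∷ᵘ K)
  branches 6F = pairᵘ v (π₂ᵘ d ∷ᵘ π₁ᵘ d ∷ᵘ K)
  branches 7F = comp₂ᵘ atRec recActᵘ idᵘ (π₂ᵘ v)
  branches 8F = pairᵘ (pairᵘ v (constᵘ 0))
    (d ∷ᵘ pairᵘ (constᵘ 11) (pairᵘ d (pairᵘ v (constᵘ 0))) ∷ᵘ K)
  branches 9F = pairᵘ (π₁ᵘ d) (π₂ᵘ d ∷ᵘ pairᵘ (constᵘ 10) v ∷ᵘ K)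
  branches (suc 9F) = pairᵘ (pairᵘ d v) K

-- DIS ≤sW NRNG

isZero : ℕ → Fin 2
isZero zero    = 1F
isZero (suc _) = 0F

isZeroᵘ : Uniform f → Uniform λ s n → toℕ (isZero (f s n))
isZeroᵘ = comp₂ᵘ test (caseᵘ test (constᵘ 1) (constᵘ 0)) idᵘ
  where
  test : Baire → ℕ → ℕ → ℕ
  test _ _ n = toℕ (isZero n)

-- Recovering the oracle from the input of `U`

parity : ℕ → ℕ
parity zero    = 0
parity (suc n) = toℕ (isZero (parity n))

-- Passing to the next place swaps the two sequences as well as the parity, so the two claims reduce
-- to each other.
⟪⟫-even-part : ∀ {r p p′} n → parity n ≡ 0 → ⟪ r , p ⟫ n ≡ ⟪ r , p′ ⟫ n
⟪⟫-odd-part  : ∀ {r r′ p} n {k} → parity n ≡ suc k → ⟪ r , p ⟫ n ≡ ⟪ r′ , p ⟫ n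
⟪⟫-even-part zero    e = refl
⟪⟫-even-part (suc n) e with suc k ← parity n in eq = ⟪⟫-odd-part n eq
⟪⟫-odd-part  (suc n) e with zero ← parity n in eq = ⟪⟫-even-part n eq

-- The oracle ⟪ r , p ⟫ recovered from s = ⟪ i ◂ r , p ⟫: r is found two places
-- further on, while p is in place.
untagAt : Baire → ℕ → ℕ → ℕ
untagAt s n zero    = s (2 + n)
untagAt s n (suc _) = s n

untag : Baire → Baire
untag s n = untagAt s n (parity n)

untag-correct : ∀ {s i r p} → s ≗ ⟪ i ◂ r , p ⟫ → untag s ≗ ⟪ r , p ⟫
untag-correct e n with parity n in eq
-- `⟪ i ◂ r , p ⟫ (2 + n)` unfolds to `⟪ r , p ∘ suc ⟫ n`, and at even `n` only `r` is read.
... | zero  = trans (e (2 + n)) (⟪⟫-even-part n eq)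
... | suc _ = trans (e n) (⟪⟫-odd-part n eq)

untagᵘ : Uniform untag
untagᵘ = comp₂ᵘ untagAt (caseᵘ untagAt (oracleᵘ (sucᵘ (sucᵘ idᵘ))) (oracleᵘ (π₁ᵘ idᵘ))) idᵘ
  (comp₂ᵘ (λ _ _ → parity)
    (recᵘ (λ _ _ → parity) (constᵘ 0) (isZeroᵘ (π₂ᵘ (π₂ᵘ idᵘ)))
      λ s x n → sym (trans
        (cong (toℕ ∘ isZero ∘ π₂) (π₂-pair x ⟨ n , parity n ⟩))
        (cong (toℕ ∘ isZero) (π₂-pair n (parity n)))))
    idᵘ idᵘ)

-- A stack `K` other than 0 means that the run is unfinished. Output 0 contributes nothing to the
-- range, while `suc n` contributes `n`.
report : (n K b : ℕ) → ℕ
report n zero    zero    = 0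
report n zero    (suc _) = suc n
report n (suc _) _       = 0

report-inverse : ∀ n K b {k} → report n K b ≡ suc k → n ≡ k × K ≡ 0 × ∃[ c ] b ≡ suc c
report-inverse n zero (suc b) refl = refl , refl , b , refl

reportState : Baire → (n σ : ℕ) → ℕ
reportState _ n σ = report n (π₂ σ) (π₁ σ)

reportStateᵘ : Uniform₂ reportState
reportStateᵘ = comp₂ᵘ (λ s z K → report (π₁ z) K (π₁ (π₂ z)))
  (caseᵘ (λ s z K → report (π₁ z) K (π₁ (π₂ z)))
    (comp₂ᵘ (λ s n b → report n 0 b)
      (caseᵘ (λ s n b → report n 0 b) (constᵘ 0) (sucᵘ (π₁ᵘ idᵘ)))
      (π₁ᵘ idᵘ) (π₁ᵘ (π₂ᵘ idᵘ)))
    (constᵘ 0))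
  idᵘ (π₂ᵘ (π₂ᵘ idᵘ))

-- Enumerating the support of the simulated function

module _ (code : ℕ → ℕ) (codeᵘ : Computableℕ code) where

  simulate : Baire → (n t : ℕ) → ℕ
  simulate s n t = fold ⟨ n , code (s 0) ∷ 0 ⟩ (step (untag s)) t

  simulateᵘ : Uniform₂ simulate
  simulateᵘ = recᵘ simulate
    (pairᵘ idᵘ (compᵘ (λ _ → code) codeᵘ (oracleᵘ (constᵘ 0)) ∷ᵘ constᵘ 0))
    (stepᵘ untagᵘ (π₂ᵘ (π₂ᵘ idᵘ)))
    λ s n t → sym (cong (step (untag s)) (trans
      (cong π₂ (π₂-pair n ⟨ t , simulate s n t ⟩)) (π₂-pair t (simulate s n t))))

  -- The number ⟨ n , t ⟩ contributes n if the program halts on n within t steps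
  -- with a nonzero value.
  enumerate : Baire → Baire
  enumerate s m = reportState s (π₁ m) (simulate s (π₁ m) (π₂ m))

  enumerateᵘ : Uniform enumerate
  enumerateᵘ = comp₂ᵘ reportState reportStateᵘ (π₁ᵘ idᵘ)
    (comp₂ᵘ simulate simulateᵘ (π₁ᵘ idᵘ) (π₂ᵘ idᵘ))

  enumerate-range : ∀ {s} c (A : Cantor) → ⌜ c ⌝ ≡ code (s 0) →
                    (∀ n → ⟦ c ⟧ (untag s) n (toℕ (A n))) →
                    graph RangeMinusOne (enumerate s) A
  enumerate-range {s} c A e computes k = mk⇔ enumerated member
    where
    halts : ∀ k → ∃[ t ] simulate s k t ≡ ⟨ toℕ (A k) , 0 ⟩
    halts k = subst (λ i → _⟶*_ (untag s) ⟨ k , i ∷ 0 ⟩ ⟨ toℕ (A k) , 0 ⟩) e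
      (simulates (untag s) c (computes k) 0)

    enumerated : k ∈ A → ∃[ m ] enumerate s m ≡ suc k
    enumerated k∈A with t , h ← halts k = ⟨ k , t ⟩ ,
      trans (unpaired (λ n t → reportState s n (simulate s n t)) k t)
      (trans (cong (reportState s k) h)
      (trans (unpaired (λ b K → report k K b) (toℕ (A k)) 0)
             (cong (report k 0 ∘ toℕ) k∈A)))

    nonzero : ∀ {i : Fin 2} {c} → suc c ≡ toℕ i → i ≡ 1F
    nonzero {1F} _ = refl

    member : ∃[ m ] enumerate s m ≡ suc k → k ∈ A
    member (m , e) with refl , K≡0 , b , b≡ ← report-inverse (π₁ m) _ _ e =
      -- The run that reported `k` ended with `suc b`, and the correct run ends with `A k`; so `A k`
      -- cannot be 0.
      nonzero (halt-unique (untag s) {b = suc b} {b′ = toℕ (A (π₁ m))}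
        (π₂ m , trans (sym (pair-unpair _)) (cong₂ ⟨_,_⟩ b≡ K≡0))
        (halts (π₁ m)))

module _ (𝒢 : GödelNumbering) where
  open GödelNumbering 𝒢

  DIS≤NRNG : DIS 𝒢 ≤sW NRNG
  DIS≤NRNG = avoid-reduction {BaireSpace} {CantorSpace} (U 𝒢) RangeMinusOne
    (avoid-total CantorSpace RangeMinusOne {const 0F} {const 1F} λ e → Fin.0≢1+n (e 0))
    (λ q → q) (enumerate toProgram toProgram-comp) (oracleᵘ idᵘ)
    (enumerateᵘ toProgram toProgram-comp)
    (λ s q A q≗A → q , (λ _ → refl) , λ (i , r , p , s≗ , h) →
      -- The program is taken from the computation at 0; injectivity of the coding shows that the
      -- computation at every other `n` uses the same one.
      let c , ⌜c⌝≡ , _ = to (toProgram-corr i _ _ _) (h 0) in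
      enumerate-range toProgram toProgram-comp c A (trans ⌜c⌝≡ (cong toProgram (sym (s≗ 0))))
        λ n →
          let d , ⌜d⌝≡ , hd = to (toProgram-corr i _ _ _) (h n) in
          ⟦⟧-resp c (sym ∘ untag-correct s≗)
            (subst₂ (λ d b → ⟦ d ⟧ ⟪ r , p ⟫ n b)
              (⌜⌝-injective d c (trans ⌜d⌝≡ (sym ⌜c⌝≡))) (q≗A n) hd))
    (realizable (DIS 𝒢)) (realizable NRNG)

-- NRNG ≤sW DIS

distance : ℕ → ℕ → ℕ
distance m n = (m ∸ n) + (n ∸ m)

distance≡0⇒≡ : ∀ m n → distance m n ≡ 0 → m ≡ n
distance≡0⇒≡ m n e = ≤-antisym
  (m∸n≡0⇒m≤n (m+n≡0⇒m≡0 (m ∸ n) e)) (m∸n≡0⇒m≤n (m+n≡0⇒n≡0 (m ∸ n) e))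

distance-refl : ∀ n → distance n n ≡ 0
distance-refl n = cong₂ _+_ (n∸n≡0 n) (n∸n≡0 n)

predᵘ : Uniform f → Uniform λ s n → pred (f s n)
predᵘ = comp₂ᵘ (λ _ _ → pred) (caseᵘ (λ _ _ → pred) (constᵘ 0) (π₂ᵘ idᵘ)) idᵘ

distanceᵘ : Uniform f → Uniform g → Uniform λ s n → distance (f s n) (g s n)
distanceᵘ hf hg = comp₂ᵘ plus plusᵘ (comp₂ᵘ minus minusᵘ hf hg) (comp₂ᵘ minus minusᵘ hg hf)
  where
  plus minus : Baire → ℕ → ℕ → ℕ
  plus  _ m n = m + n
  minus _ m n = m ∸ n

  result : ∀ x n y → π₂ (π₂ ⟨ x , ⟨ n , y ⟩ ⟩) ≡ y
  result x n y = trans (cong π₂ (π₂-pair x ⟨ n , y ⟩)) (π₂-pair n y)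

  plusᵘ : Uniform₂ plus
  plusᵘ = recᵘ plus (extᵘ (λ _ n → sym (+-identityʳ n)) idᵘ) (sucᵘ (π₂ᵘ (π₂ᵘ idᵘ)))
    λ _ m n → trans (+-suc m n) (cong suc (sym (result m n (m + n))))

  minusᵘ : Uniform₂ minus
  minusᵘ = recᵘ minus idᵘ (predᵘ (π₂ᵘ (π₂ᵘ idᵘ)))
    λ _ m n → trans (sym (pred[m∸n]≡m∸[1+n] m n)) (cong pred (sym (result m n (m ∸ n))))

-- Graphs and the search for function values

graphSet : Baire → Cantor
graphSet q z = isZero (distance (q (π₁ z)) (π₂ z))

∈-graphSet : ∀ q z → z ∈ graphSet q ⇔ q (π₁ z) ≡ π₂ z
∈-graphSet q z = mk⇔ (λ h → distance≡0⇒≡ _ _ (isZero⁻¹ h))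
  λ e → cong isZero (trans (cong (distance (q (π₁ z))) (sym e)) (distance-refl (q (π₁ z))))
  where
  isZero⁻¹ : ∀ {n} → isZero n ≡ 1F → n ≡ 0
  isZero⁻¹ {zero} _ = refl

graphSetᵘ : Uniform λ q → toℕ ∘ graphSet q
graphSetᵘ = isZeroᵘ (distanceᵘ (oracleᵘ (π₁ᵘ idᵘ)) (π₂ᵘ idᵘ))

-- Induction on a known zero, shifting `f` by one place when `f 0` is positive. The result has the
-- form that `Minimise` asks for.
least-zero : ∀ (f : ℕ → ℕ) m → f m ≡ 0 →
             ∃[ b ] f b ≡ 0 × (∀ m → m < b → ∃[ k ] f m ≡ suc k)
least-zero f zero    e = 0 , e , λ _ ()
least-zero f (suc m) e with f 0 in f0
... | zero  = 0 , f0 , λ _ ()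
... | suc k with b , fb , below ← least-zero (f ∘ suc) m e =
  suc b , fb , λ { zero _ → k , f0 ; (suc m) (s≤s m<b) → below m m<b }

-- The entry 0 lists no element, so it must count as a mismatch: hence the value 1.
mismatch : (n x : ℕ) → ℕ
mismatch n zero    = 1
mismatch n (suc z) = distance n (π₁ z)

mismatch≡0 : ∀ n x → mismatch n x ≡ 0 → ∃[ z ] x ≡ suc z × n ≡ π₁ z
mismatch≡0 n (suc z) e = z , refl , distance≡0⇒≡ n (π₁ z) e

search : ∃[ c ] ∀ w q → graph RangeMinusOne w (graphSet q) → ∀ n → ⟦ c ⟧ w n (q n)
search with testᵘ ← comp₂ᵘ (λ _ → mismatch)
                      (caseᵘ (λ _ → mismatch) (constᵘ 1)
                        (distanceᵘ (π₁ᵘ idᵘ) (π₁ᵘ (π₂ᵘ idᵘ))))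
                      (π₁ᵘ idᵘ) (oracleᵘ (π₂ᵘ idᵘ))
          | outᵘ ← π₂ᵘ (predᵘ (oracleᵘ idᵘ))
  = compᶜ (proj₁ outᵘ) (μᶜ (proj₁ testᵘ)) , λ w q range n →
    let test : ∀ m {v} → mismatch n (w m) ≡ v → ⟦ proj₁ testᵘ ⟧ w ⟨ n , m ⟩ v
        test m e = subst (⟦ proj₁ testᵘ ⟧ w ⟨ n , m ⟩)
          (trans (unpaired (λ n m → mismatch n (w m)) n m) e) (proj₂ testᵘ w ⟨ n , m ⟩)
        m , wm = to (range ⟨ n , q n ⟩)
          (from (∈-graphSet q ⟨ n , q n ⟩)
            (trans (cong q (π₁-pair n (q n))) (sym (π₂-pair n (q n)))))
        b , found , below = least-zero (λ m → mismatch n (w m)) m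
          (trans (cong (mismatch n) wm)
          (trans (cong (distance n) (π₁-pair n (q n))) (distance-refl n)))
        -- The place found may differ from `m`, but any element of the graph with first component
        -- `n` has second component `q n`.
        z , wb , n≡ = mismatch≡0 n (w b) found
    in b , (test b found , λ m m<b → proj₁ (below m m<b) , test m (proj₂ (below m m<b))) ,
       subst (⟦ proj₁ outᵘ ⟧ w b)
         (trans (cong (π₂ ∘ pred) wb)
         (trans (sym (to (∈-graphSet q z) (from (range z) (b , wb)))) (cong q (sym n≡))))
         (proj₂ outᵘ w b)

-- Splitting and interleaving sequences

evens odds : Baire → Baire
evens p zero    = p 0
evens p (suc n) = evens (λ k → p (2 + k)) n
odds p = evens (p ∘ suc)

⟪⟫-split : ∀ p n → p n ≡ ⟪ evens p , odds p ⟫ n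
⟪⟫-split p zero    = refl
⟪⟫-split p (suc n) = ⟪⟫-split (p ∘ suc) n

⟪⟫-source : ∀ p q n → (∃[ k ] p k ≡ ⟪ p , q ⟫ n) ⊎ (∃[ k ] q k ≡ ⟪ p , q ⟫ n)
⟪⟫-source p q zero    = inj₁ (0 , refl)
⟪⟫-source p q (suc n) with ⟪⟫-source q (p ∘ suc) n
... | inj₁ k       = inj₂ k
... | inj₂ (k , e) = inj₁ (suc k , e)

⟪⟫-swap-range : ∀ p q {x} → ∃[ n ] ⟪ p , q ⟫ n ≡ x → ∃[ m ] ⟪ q , p ⟫ m ≡ x
⟪⟫-swap-range p q (n , refl) with ⟪⟫-source p q n
... | inj₁ (k , e) = 1 + 2 * k , trans (⟪⟫-odd q p k) e
... | inj₂ (k , e) = 2 * k , trans (⟪⟫-even q p k) e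

◂ᵘ : ∀ i → Uniform (i ◂_)
◂ᵘ i = comp₂ᵘ (λ p _ → i ◂ p)
  (caseᵘ (λ p _ → i ◂ p) (constᵘ i) (oracleᵘ (π₂ᵘ idᵘ))) idᵘ idᵘ

module _ (𝒢 : GödelNumbering) where
  open GödelNumbering 𝒢

  NRNG≤DIS : NRNG ≤sW DIS 𝒢
  NRNG≤DIS with c , c-correct ← search =
   avoid-reduction {CantorSpace} {BaireSpace} RangeMinusOne (U 𝒢)
    (avoid-total BaireSpace (U 𝒢) {const 0} {const 1} λ e → 0≢1+n (e 0))
    (λ q → toℕ ∘ graphSet q) (index c ◂_) graphSetᵘ (◂ᵘ (index c))
    (λ p q q′ q≗q′ → graphSet q , (λ _ → refl) , λ range →
      -- Prefixing the index shifts `p` by one place: its even entries move to the odd places, its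
      -- odd entries to the even places behind the index.
      index c , odds p , evens p ,
      (λ { zero → refl ; (suc n) → ⟪⟫-split p n }) ,
      λ n → to (fromProgram-corr ⌜ c ⌝ _ _ _)
        (c , refl , subst (⟦ c ⟧ _ n) (q≗q′ n) (c-correct _ q (reorder p range) n)))
    (realizable NRNG) (realizable (DIS 𝒢))
    where
    index : Code → ℕ
    index c = fromProgram ⌜ c ⌝

    -- The program sees ⟪ odds p , evens p ⟫, which has the same range as p.
    reorder : ∀ p {A} → graph RangeMinusOne p A →
              graph RangeMinusOne ⟪ odds p , evens p ⟫ A
    reorder p range k = mk⇔
      (λ k∈A → let n , pn = to (range k) k∈A in
        ⟪⟫-swap-range (evens p) (odds p) (n , trans (sym (⟪⟫-split p n)) pn))
      λ e → let n , pn = ⟪⟫-swap-range (odds p) (evens p) e in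
        from (range k) (n , trans (⟪⟫-split p n) pn)

proposition1p13 : (𝒢 : GödelNumbering) → DIS 𝒢 ≡sW NRNG
proposition1p13 𝒢 = DIS≤NRNG 𝒢 , NRNG≤DIS 𝒢
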